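{- Let $u$ be a nonprincipal ultrafilter on $\mathbb{Z}$. If $u$ is $(\mathbb{Z},3)$-Ramsey, then $u$ is selective.
   Context: For $n\geq 1$, a colouring $c:[\mathbb{Z}]^n\to 2$ (where $[\mathbb{Z}]^n$ is the set of $n$-element subsets of $\mathbb{Z}$ and $2=\{0,1\}$) is $\mathbb{Z}$-invariant if $c(\{x_1,\ldots,x_n\})=c(\{x_1+z,\ldots,x_n+z\})$ for all $\{x_1,\ldots,x_n\}\in[\mathbb{Z}]^n$ and all $z\in\mathbb{Z}$. An ultrafilter $u$ on $\mathbb{Z}$ is $(\mathbb{Z},n)$-Ramsey if for every $\mathbb{Z}$-invariant colouring $c:[\mathbb{Z}]^n\to 2$ there is $A\in u$ such that $c$ is constant on $[A]^n$. A nonprincipal ultrafilter $u$ on a countable set $S$ is selective (equivalently, Ramsey) if for every partition of $S$, either some piece of the partition belongs to $u$ or there is $A\in u$ meeting each piece in at most one point. -}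

module Defs where

open import Data.Bool.Base using (Bool)
open import Data.Integer.Base using (ℤ; _+_)
open import Data.Integer.Properties using (+-0-abelianGroup)
open import Data.Nat.Base using (ℕ)
open import Data.Product.Base using (∃; _×_; _,_)
open import Data.Sum.Base using (_⊎_)
open import Data.Vec.Base using (Vec; map)
open import Data.Vec.Membership.Propositional using () renaming (_∈_ to _∈ᵛ_)
open import Data.Vec.Relation.Unary.Unique.Propositional using (Unique)
open import Data.Vec.Relation.Unary.Unique.Propositional.Properties using (map⁺)
open import Function.Bundles using (Func; _⇔_; _⟨$⟩_)
open import Level using (Level; 0ℓ; _⊔_) renaming (suc to lsuc)
open import Relation.Binary.Bundles using (Setoid)
open import Relation.Binary.PropositionalEquality using (_≡_; setoid)
open import Relation.Binary.Structures using (IsEquivalence)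
open import Relation.Nullary.Negation.Core using (¬_)
open import Relation.Unary
  using (Pred; _∈_; _∉_; _⊆_; _≐_; _≬_; _∩_; ∁; U; ∅; Satisfiable)
open import Relation.Unary.Relation.Binary.Equality using (≐-isEquivalence)

import Algebra.Properties.AbelianGroup +-0-abelianGroup as ℤ-Group

private
  variable
    ℓ : Level
    S : Set
    n : ℕ

Subset : Set → Set₁
Subset S = Pred S 0ℓ

-- The level ℓ of the membership predicate is arbitrary, so that ultrafilters
-- defined by quantifying over subsets are included.
record Ultrafilter (S : Set) (ℓ : Level) : Set (lsuc 0ℓ ⊔ lsuc ℓ) where
  field
    sets  : Pred (Subset S) ℓ
    U∈    : U ∈ sets
    ∅∉    : ∅ ∉ sets
    ⊆-up  : ∀ {A B} → A ⊆ B → A ∈ sets → B ∈ sets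
    ∩∈    : ∀ {A B} → A ∈ sets → B ∈ sets → (A ∩ B) ∈ sets
    ultra : ∀ A → A ∈ sets ⊎ ∁ A ∈ sets

open Ultrafilter public using (sets)

infix 4 _∈ᵘ_

_∈ᵘ_ : Subset S → Ultrafilter S ℓ → Set ℓ
A ∈ᵘ u = A ∈ sets u

Principal : Ultrafilter S ℓ → Set (lsuc 0ℓ ⊔ ℓ)
Principal {S = S} u = ∃ λ (s : S) → ∀ A → A ∈ᵘ u ⇔ s ∈ A

Nonprincipal : Ultrafilter S ℓ → Set (lsuc 0ℓ ⊔ ℓ)
Nonprincipal u = ¬ Principal u

-- The partition is the set { piece i ∣ i : Index } of subsets of S.  The
-- indexing may repeat a piece: it is only required that pieces which are
-- different as sets do not overlap.
record Partition (S : Set) : Set₁ where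
  field
    Index     : Set
    piece     : Index → Subset S
    inhabited : ∀ i → Satisfiable (piece i)
    disjoint  : ∀ i j → piece i ≬ piece j → piece i ≐ piece j
    covers    : ∀ s → ∃ λ i → s ∈ piece i

AtMostOne : Subset S → Set
AtMostOne A = ∀ x y → x ∈ A → y ∈ A → x ≡ y

Selective : Ultrafilter S ℓ → Set (lsuc 0ℓ ⊔ ℓ)
Selective {S = S} u = ∀ (P : Partition S) → let open Partition P in
  (∃ λ i → piece i ∈ᵘ u) ⊎
  (∃ λ A → A ∈ᵘ u × (∀ i → AtMostOne (A ∩ piece i)))

-- An n-element subset is presented by an enumeration without repetitions;
-- by _≈_ below, two presentations are equal when they enumerate the same set.
record FinSubset (S : Set) (n : ℕ) : Set where
  constructor _,_
  field
    elements : Vec S n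
    distinct : Unique elements

⟦_⟧ : FinSubset S n → Subset S
⟦ s ⟧ x = x ∈ᵛ FinSubset.elements s

[_]^_ : Set → ℕ → Setoid 0ℓ 0ℓ
[ S ]^ n = record
  { Carrier       = FinSubset S n
  ; _≈_           = λ s t → ⟦ s ⟧ ≐ ⟦ t ⟧
  ; isEquivalence = record
    { refl  = ≐.refl
    ; sym   = ≐.sym
    ; trans = ≐.trans
    }
  }
  where module ≐ = IsEquivalence (≐-isEquivalence {A = S} {0ℓ})

Colouring : Set → ℕ → Set
Colouring S n = Func ([ S ]^ n) (setoid Bool)

ConstantOn : Colouring S n → Subset S → Set
ConstantOn c A = ∀ s t → ⟦ s ⟧ ⊆ A → ⟦ t ⟧ ⊆ A → c ⟨$⟩ s ≡ c ⟨$⟩ t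

translate : ℤ → FinSubset ℤ n → FinSubset ℤ n
translate z (xs , xs!) =
  map (_+ z) xs , map⁺ (λ {x} {y} → ℤ-Group.∙-cancelʳ z x y) xs!

ℤ-Invariant : Colouring ℤ n → Set
ℤ-Invariant c = ∀ s z → c ⟨$⟩ s ≡ c ⟨$⟩ translate z s

⟨ℤ,_⟩-Ramsey : ℕ → Ultrafilter ℤ ℓ → Set (lsuc 0ℓ ⊔ ℓ)
⟨ℤ, n ⟩-Ramsey u = ∀ (c : Colouring ℤ n) → ℤ-Invariant c →
  ∃ λ A → A ∈ᵘ u × ConstantOn c A

{-# OPTIONS --safe #-}

-- Colouring x < y < z by whether y − x < z − y yields A ∈ u on which the gaps
-- of triples always grow or always shrink, so that a difference y − x of
-- elements of A determines the pair (x , y).  Hence every colouring of the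
-- pairs of A comes from a colouring of their differences, and the latter is a
-- ℤ-invariant colouring of triples that ignores the largest element.  Apply
-- the Ramsey property to the colouring "x and y lie in the same piece".

module Submission where

open import Axiom.ExcludedMiddle using (ExcludedMiddle)
open import Data.Empty using (⊥-elim)
open import Data.Integer.Base using (ℤ; _+_; _-_; -_; _<_; _>_)
open import Data.Integer.Properties
  using (<-cmp; <-irrefl; <-asym; <-trans; <-≤-trans; ≮⇒≥; +-monoˡ-<;
         <-isStrictPartialOrder)
open import Data.Integer.Tactic.RingSolver using (solve-∀)
open import Data.Nat.Base using (ℕ)
open import Data.Product.Base using (∃; ∃₂; _×_; _,_; proj₁; proj₂)
open import Data.Sum.Base using (_⊎_; inj₁; inj₂)
open import Data.Vec.Base using (Vec; []; _∷_; map)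
open import Data.Vec.Membership.Propositional using () renaming (_∈_ to _∈ᵛ_)
open import Data.Vec.Membership.Propositional.Properties using (∈-map⁺; fromAny)
open import Data.Vec.Relation.Unary.All using ([]; _∷_)
open import Data.Vec.Relation.Unary.AllPairs using ([]; _∷_)
open import Data.Vec.Relation.Unary.Any using (here; there)
open import Data.Vec.Relation.Unary.Any.Properties using (map⁻)
open import Function.Base using (_∘_; id)
open import Function.Bundles using (_⇔_; mk⇔)
open import Level using (Level; 0ℓ)
open import Relation.Binary.Construct.Flip.EqAndOrd using (isStrictPartialOrder)
open import Relation.Binary.Core using (Rel)
open import Relation.Binary.Definitions using (tri<; tri≈; tri>)
open import Relation.Binary.PropositionalEquality
  using (_≡_; refl; sym; trans; cong; subst; subst₂)
open import Relation.Binary.Structures using (IsStrictPartialOrder)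
open import Relation.Nullary.Decidable using (Dec; yes; no; does; does-⇔)
open import Relation.Nullary.Negation using (¬_)
open import Relation.Unary using (_∈_; _⊆_; _∩_; ∁; Satisfiable)

open import Defs

private
  variable
    ℓ : Level
    n : ℕ
    S : Set

does-≡⇒ : ∀ {P Q : Set} (p? : Dec P) (q? : Dec Q) → does p? ≡ does q? → P → Q
does-≡⇒ _       (yes q) _  _ = q
does-≡⇒ (no ¬p) (no _)  _  p = ⊥-elim (¬p p)
does-≡⇒ (yes _) (no _)  ()

∈-map⁻ : ∀ {A B : Set} (f : A → B) {xs : Vec A n} {y} →
  y ∈ᵛ map f xs → ∃ λ x → x ∈ᵛ xs × y ≡ f x
∈-map⁻ f = fromAny ∘ map⁻

-- Members of an ultrafilter.

module _ (em : ExcludedMiddle 0ℓ) (u : Ultrafilter S ℓ) where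

  open Ultrafilter u using (∅∉; ⊆-up; ∩∈)

  satisfiable : ∀ {A} → A ∈ᵘ u → Satisfiable A
  satisfiable {A} A∈u with em {Satisfiable A}
  ... | yes a = a
  ... | no ¬a = ⊥-elim (∅∉ (⊆-up (λ {x} x∈A → ¬a (x , x∈A)) A∈u))

  atMostOne⇒principal : ∀ {A} → A ∈ᵘ u → AtMostOne A → Principal u
  atMostOne⇒principal {A} A∈u A≤1 with satisfiable A∈u
  ... | s , s∈A = s , λ B → mk⇔
    (λ B∈u → let x , x∈A , x∈B = satisfiable (∩∈ A∈u B∈u) in
             subst B (A≤1 x s x∈A s∈A) x∈B)
    (λ s∈B → ⊆-up (λ {x} x∈A → subst B (A≤1 s x s∈A x∈A) s∈B) A∈u)

NonMaximal : Subset ℤ → Subset ℤ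
NonMaximal A x = x ∈ A × ∃ λ y → y ∈ A × x < y

-- At most one point of `A` has no point of `A` above it, and a set with at most one point is in `u`
-- only if `u` is principal. Passing to `NonMaximal A` lets every increasing pair be completed to an
-- increasing triple.
nonMaximal-∈ : ExcludedMiddle 0ℓ → (u : Ultrafilter ℤ ℓ) → Nonprincipal u →
  ∀ {A} → A ∈ᵘ u → NonMaximal A ∈ᵘ u
nonMaximal-∈ em u np {A} A∈u with Ultrafilter.ultra u (NonMaximal A)
... | inj₁ A′∈u  = A′∈u
... | inj₂ ∁A′∈u =
  ⊥-elim (np (atMostOne⇒principal em u (Ultrafilter.∩∈ u A∈u ∁A′∈u) ≤1))
  where
  ≤1 : AtMostOne (A ∩ ∁ (NonMaximal A))
  ≤1 x y (x∈A , x∉) (y∈A , y∉) with <-cmp x y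
  ... | tri< x<y _ _ = ⊥-elim (x∉ (x∈A , y , y∈A , x<y))
  ... | tri≈ _ x≡y _ = x≡y
  ... | tri> _ _ y<x = ⊥-elim (y∉ (y∈A , x , x∈A , y<x))

-- Triples coloured by their gaps.

triple : ∀ {x y z} → x < y → y < z → FinSubset ℤ 3
triple {x} {y} {z} x<y y<z = x ∷ y ∷ z ∷ [] ,
  (≢ x<y ∷ ≢ (<-trans x<y y<z) ∷ []) ∷ (≢ y<z ∷ []) ∷ [] ∷ []
  where
  ≢ : ∀ {i j} → i < j → ¬ i ≡ j
  ≢ i<j i≡j = <-irrefl i≡j i<j

triple-⊆ : ∀ {x y z} (x<y : x < y) (y<z : y < z) {A : Subset ℤ} →
  x ∈ A → y ∈ A → z ∈ A → ⟦ triple x<y y<z ⟧ ⊆ A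
triple-⊆ _ _ x∈A y∈A z∈A (here refl)                 = x∈A
triple-⊆ _ _ x∈A y∈A z∈A (there (here refl))         = y∈A
triple-⊆ _ _ x∈A y∈A z∈A (there (there (here refl))) = z∈A

-- Existential over increasing triples, so that it depends on the set alone: no enumeration has to
-- be sorted, and the colouring respects equality of finite subsets.
HasGaps : Rel ℤ 0ℓ → Subset ℤ → Set
HasGaps χ A = ∃ λ x → ∃₂ λ y z →
  (x ∈ A × y ∈ A × z ∈ A) × x < y × y < z × χ (y - x) (z - y)

hasGaps-mono : ∀ χ {A B} → A ⊆ B → HasGaps χ A → HasGaps χ B
hasGaps-mono χ A⊆B (x , y , z , (x∈ , y∈ , z∈) , r) =
  x , y , z , (A⊆B x∈ , A⊆B y∈ , A⊆B z∈) , r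

-- A three-element set contains a single increasing triple: the middle witness has an element on
-- either side, so it is `y`, which leaves `x` below and `z` above.
hasGaps-triple : ∀ χ {x y z} (x<y : x < y) (y<z : y < z) →
  HasGaps χ ⟦ triple x<y y<z ⟧ → χ (y - x) (z - y)
hasGaps-triple χ {x} {y} {z} x<y y<z
  (a , b , c , (a∈ , b∈ , c∈) , a<b , b<c , χabc) =
  extract a∈ (middle b∈) c∈ a<b b<c χabc
  where
  s = ⟦ triple x<y y<z ⟧

  ≮x : ∀ {i} → i ∈ s → ¬ i < x
  ≮x (here refl)                 = <-irrefl refl
  ≮x (there (here refl))         = <-asym x<y
  ≮x (there (there (here refl))) = <-asym (<-trans x<y y<z)

  z≮ : ∀ {i} → i ∈ s → ¬ z < i
  z≮ (here refl)                 = <-asym (<-trans x<y y<z)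
  z≮ (there (here refl))         = <-asym y<z
  z≮ (there (there (here refl))) = <-irrefl refl

  middle : b ∈ s → b ≡ y
  middle (here refl)                 = ⊥-elim (≮x a∈ a<b)
  middle (there (here refl))         = refl
  middle (there (there (here refl))) = ⊥-elim (z≮ c∈ b<c)

  extract : ∀ {a b c} → a ∈ s → b ≡ y → c ∈ s → a < b → b < c →
    χ (b - a) (c - b) → χ (y - x) (z - y)
  extract (here refl) refl (there (there (here refl))) _ _ χxyz = χxyz
  extract (there (here refl)) refl _ a<y _ _ = ⊥-elim (<-irrefl refl a<y)
  extract (there (there (here refl))) refl _ a<y _ _ = ⊥-elim (<-asym y<z a<y)
  extract _ refl (here refl) _ y<c _ = ⊥-elim (<-asym x<y y<c)
  extract _ refl (there (here refl)) _ y<c _ = ⊥-elim (<-irrefl refl y<c)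

translate-gap : ∀ i j k → (i + k) - (j + k) ≡ i - j
translate-gap = solve-∀

hasGaps-translate : ∀ χ (s : FinSubset ℤ n) k →
  HasGaps χ ⟦ s ⟧ ⇔ HasGaps χ ⟦ translate k s ⟧
hasGaps-translate χ s k = mk⇔ to from
  where
  shift : ∀ x y z → χ (y - x) (z - y) ≡ χ ((y + k) - (x + k)) ((z + k) - (y + k))
  shift x y z rewrite translate-gap y x k | translate-gap z y k = refl

  unshift : ∀ {i j} → i + k < j + k → i < j
  unshift {i} {j} i+k<j+k =
    subst₂ _<_ (cancel i k) (cancel j k) (+-monoˡ-< (- k) i+k<j+k)
    where
    cancel : ∀ i k → (i + k) - k ≡ i
    cancel = solve-∀

  to : HasGaps χ ⟦ s ⟧ → HasGaps χ ⟦ translate k s ⟧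
  to (x , y , z , (x∈ , y∈ , z∈) , x<y , y<z , χxyz) =
    x + k , y + k , z + k ,
    (∈-map⁺ (_+ k) x∈ , ∈-map⁺ (_+ k) y∈ , ∈-map⁺ (_+ k) z∈) ,
    +-monoˡ-< k x<y , +-monoˡ-< k y<z , subst id (shift x y z) χxyz

  from : HasGaps χ ⟦ translate k s ⟧ → HasGaps χ ⟦ s ⟧
  from (_ , _ , _ , (x∈ , y∈ , z∈) , x<y , y<z , χxyz)
    with ∈-map⁻ (_+ k) x∈ | ∈-map⁻ (_+ k) y∈ | ∈-map⁻ (_+ k) z∈
  ... | x , x∈s , refl | y , y∈s , refl | z , z∈s , refl =
    x , y , z , (x∈s , y∈s , z∈s) , unshift x<y , unshift y<z ,
    subst id (sym (shift x y z)) χxyz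

OnGaps : Rel ℤ 0ℓ → Subset ℤ → Set
OnGaps χ A = ∀ {x y z} → x ∈ A → y ∈ A → z ∈ A → x < y → y < z → χ (y - x) (z - y)

ramsey-gaps : ExcludedMiddle 0ℓ → (u : Ultrafilter ℤ ℓ) → ⟨ℤ, 3 ⟩-Ramsey u →
  (χ : Rel ℤ 0ℓ) →
  ∃ λ A → A ∈ᵘ u × (OnGaps χ A ⊎ OnGaps (λ a b → ¬ χ a b) A)
ramsey-gaps em u ramsey χ = A , A∈u , dichotomy
  where
  has? : (s : FinSubset ℤ 3) → Dec (HasGaps χ ⟦ s ⟧)
  has? s = em

  colour : Colouring ℤ 3
  colour = record
    { to   = does ∘ has?
    ; cong = λ {s} {t} (s⊆t , t⊆s) →
        does-⇔ (mk⇔ (hasGaps-mono χ s⊆t) (hasGaps-mono χ t⊆s)) (has? s) (has? t)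
    }

  invariant : ℤ-Invariant colour
  invariant s k =
    does-⇔ (hasGaps-translate χ s k) (has? s) (has? (translate k s))

  homogeneous = ramsey colour invariant
  A = proj₁ homogeneous
  A∈u = proj₁ (proj₂ homogeneous)
  constant = proj₂ (proj₂ homogeneous)

  dichotomy : OnGaps χ A ⊎ OnGaps (λ a b → ¬ χ a b) A
  dichotomy with em {HasGaps χ A}
  ... | no ¬has = inj₂ λ x∈ y∈ z∈ x<y y<z χxyz →
    ¬has (_ , _ , _ , (x∈ , y∈ , z∈) , x<y , y<z , χxyz)
  -- A single triple of `A` satisfying `χ` fixes the common colour, so every other triple of `A`
  -- satisfies `χ` too.
  ... | yes (x , y , z , (x∈ , y∈ , z∈) , x<y , y<z , χxyz) =
    inj₁ λ x′∈ y′∈ z′∈ x′<y′ y′<z′ →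
      let s = triple x<y y<z
          t = triple x′<y′ y′<z′
      in hasGaps-triple χ x′<y′ y′<z′
           (does-≡⇒ (has? s) (has? t)
             (constant s t (triple-⊆ x<y y<z x∈ y∈ z∈)
                           (triple-⊆ x′<y′ y′<z′ x′∈ y′∈ z′∈))
             (x , y , z ,
              (here refl , there (here refl) , there (there (here refl))) ,
              x<y , y<z , χxyz))

-- Monotone gaps make differences distinct.

j-[j-i]≡i : ∀ i j → j - (j - i) ≡ i
j-[j-i]≡i = solve-∀

Sidon : Subset ℤ → Set
Sidon A = ∀ {x y x′ y′} → x ∈ A → y ∈ A → x′ ∈ A → y′ ∈ A →
  x < y → x′ < y′ → y - x ≡ y′ - x′ → x ≡ x′ × y ≡ y′

-- The order on gaps is abstract, so that one argument serves both growing gaps (`_<_`) and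
-- shrinking gaps (`_>_`).
module _ {_≺_ : Rel ℤ 0ℓ} (≺-isSPO : IsStrictPartialOrder _≡_ _≺_)
         {A : Subset ℤ} (mono : OnGaps _≺_ A) where

  open IsStrictPartialOrder ≺-isSPO using ()
    renaming (irrefl to ≺-irrefl; trans to ≺-trans)

  private
    -- Each case finds two equal gaps related by `≺`. For y < x′ they are y - x ≺ x′ - y ≺ y′ - x′;
    -- for y = x′ they are y - x ≺ y′ - y. If the intervals overlap, then x < x′ < y < y′ and x′ - x
    -- ≺ y - x′ ≺ y′ - y, where the outer gaps agree because y - x = y′ - x′.
    y≮y′ : ∀ {x y x′ y′} → x ∈ A → y ∈ A → x′ ∈ A → y′ ∈ A →
      x < y → x′ < y′ → y - x ≡ y′ - x′ → ¬ y < y′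
    y≮y′ {x} {y} {x′} {y′} x∈ y∈ x′∈ y′∈ x<y x′<y′ eq y<y′ with <-cmp y x′
    ... | tri< y<x′ _ _ = ≺-irrefl eq
      (≺-trans (mono x∈ y∈ x′∈ x<y y<x′) (mono y∈ x′∈ y′∈ y<x′ x′<y′))
    ... | tri≈ _ refl _ = ≺-irrefl eq (mono x∈ y∈ y′∈ x<y y<y′)
    ... | tri> _ _ x′<y = ≺-irrefl x′-x≡y′-y
      (≺-trans (mono x∈ x′∈ y∈ x<x′ x′<y) (mono x′∈ y∈ y′∈ x′<y y<y′))
      where
      swap : ∀ i j k → (k - (j - i)) - i ≡ k - j
      swap = solve-∀

      y′-gap≡x′ : y′ - (y - x) ≡ x′
      y′-gap≡x′ = trans (cong (λ k → y′ - k) eq) (j-[j-i]≡i x′ y′)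

      -- Subtract the common difference from both sides of y < y′.
      x<x′ : x < x′
      x<x′ = subst₂ _<_ (j-[j-i]≡i x y) y′-gap≡x′ (+-monoˡ-< (- (y - x)) y<y′)

      x′-x≡y′-y : x′ - x ≡ y′ - y
      x′-x≡y′-y = trans (cong (λ k → k - x) (sym y′-gap≡x′)) (swap x y y′)

  monotone-gaps⇒sidon : Sidon A
  monotone-gaps⇒sidon {x} {y} {x′} {y′} x∈ y∈ x′∈ y′∈ x<y x′<y′ eq
    with <-cmp y y′
  ... | tri< y<y′ _ _ = ⊥-elim (y≮y′ x∈ y∈ x′∈ y′∈ x<y x′<y′ eq y<y′)
  ... | tri> _ _ y′<y = ⊥-elim (y≮y′ x′∈ y′∈ x∈ y∈ x′<y′ x<y (sym eq) y′<y)
  ... | tri≈ _ refl _ =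
    trans (sym (j-[j-i]≡i x y)) (trans (cong (λ k → y - k) eq) (j-[j-i]≡i x′ y)) , refl

-- From triples to pairs, and from pairs to partitions.

OnPairs : Rel ℤ 0ℓ → Subset ℤ → Set
OnPairs ρ A = ∀ {x y} → x ∈ A → y ∈ A → x < y → ρ x y

module _ (em : ExcludedMiddle 0ℓ) (u : Ultrafilter ℤ ℓ) (np : Nonprincipal u)
         (ramsey : ⟨ℤ, 3 ⟩-Ramsey u) where

  open Ultrafilter u using (⊆-up; ∩∈)

  sidon-∈ : ∃ λ A → A ∈ᵘ u × Sidon A
  sidon-∈ with ramsey-gaps em u ramsey _<_
  ... | A , A∈u , inj₁ increasing =
    A , A∈u , monotone-gaps⇒sidon <-isStrictPartialOrder increasing
  ... | A , A∈u , inj₂ nonincreasing =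
    NonMaximal A , nonMaximal-∈ em u np A∈u ,
    monotone-gaps⇒sidon (isStrictPartialOrder <-isStrictPartialOrder) decreasing
    where
    -- An element w > z makes the inequality strict: z − y < w − y ≤ y − x.
    decreasing : OnGaps _>_ (NonMaximal A)
    decreasing {y = y} (x∈ , _) (y∈ , _) (_ , w , w∈ , z<w) x<y y<z =
      <-≤-trans (+-monoˡ-< (- y) z<w)
                (≮⇒≥ (nonincreasing x∈ y∈ w∈ x<y (<-trans y<z z<w)))

  ramsey-pairs : (ρ : Rel ℤ 0ℓ) →
    ∃ λ A → A ∈ᵘ u × (OnPairs ρ A ⊎ OnPairs (λ x y → ¬ ρ x y) A)
  ramsey-pairs ρ with sidon-∈
  ... | A , A∈u , sidon =
    let B , B∈u , dichotomy = ramsey-gaps em u ramsey χ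
    in NonMaximal (A ∩ B) , nonMaximal-∈ em u np (∩∈ A∈u B∈u) , pairs dichotomy
    where
    -- This reads the first gap as a code for a pair of `A`; since `A` is Sidon, each positive `a`
    -- codes at most one pair.
    χ : Rel ℤ 0ℓ
    χ a _ = ∃₂ λ x y → (x ∈ A × y ∈ A) × x < y × y - x ≡ a × ρ x y

    pairs : ∀ {B} → OnGaps χ B ⊎ OnGaps (λ a b → ¬ χ a b) B →
      OnPairs ρ (NonMaximal (A ∩ B)) ⊎
      OnPairs (λ x y → ¬ ρ x y) (NonMaximal (A ∩ B))
    -- The larger element `z` turns the pair into a triple. The pair that `χ` yields has the same
    -- difference as (x , y), so `sidon` identifies the two.
    pairs (inj₁ all) = inj₁ λ
      { ((x∈A , x∈B) , _) ((y∈A , y∈B) , z , (_ , z∈B) , y<z) x<y →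
        let x′ , y′ , (x′∈A , y′∈A) , x′<y′ , eq , ρx′y′ =
              all x∈B y∈B z∈B x<y y<z
            x′≡x , y′≡y = sidon x′∈A y′∈A x∈A y∈A x′<y′ x<y eq
        in subst₂ ρ x′≡x y′≡y ρx′y′ }
    pairs (inj₂ none) = inj₂ λ
      { ((x∈A , x∈B) , _) ((y∈A , y∈B) , z , (_ , z∈B) , y<z) x<y ρxy →
        none x∈B y∈B z∈B x<y y<z (_ , _ , (x∈A , y∈A) , x<y , refl , ρxy) }

  selective : Selective u
  selective P = select (ramsey-pairs SamePiece)
    where
    open Partition P

    SamePiece : Rel ℤ 0ℓ
    SamePiece x y = ∃ λ i → x ∈ piece i × y ∈ piece i

    select : (∃ λ A → A ∈ᵘ u ×
        (OnPairs SamePiece A ⊎ OnPairs (λ x y → ¬ SamePiece x y) A)) →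
      (∃ λ i → piece i ∈ᵘ u) ⊎
      (∃ λ A → A ∈ᵘ u × (∀ i → AtMostOne (A ∩ piece i)))
    select (A , A∈u , inj₁ same) with satisfiable em u A∈u
    ... | x , x∈A with covers x
    ... | i , x∈i = inj₁ (i , ⊆-up A⊆i A∈u)
      where
      -- The pieces `j` and `i` overlap at `x`, so they are equal as sets even if the indices
      -- differ.
      move : ∀ {y} → SamePiece x y → y ∈ piece i
      move (j , x∈j , y∈j) = proj₁ (disjoint j i (x , x∈j , x∈i)) y∈j

      A⊆i : A ⊆ piece i
      A⊆i {y} y∈A with <-cmp x y
      ... | tri< x<y _ _ = move (same x∈A y∈A x<y)
      ... | tri≈ _ refl _ = x∈i
      ... | tri> _ _ y<x = let j , y∈j , x∈j = same y∈A x∈A y<x in move (j , x∈j , y∈j)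
    select (A , A∈u , inj₂ different) = inj₂ (A , A∈u , ≤1)
      where
      ≤1 : ∀ i → AtMostOne (A ∩ piece i)
      ≤1 i x y (x∈A , x∈i) (y∈A , y∈i) with <-cmp x y
      ... | tri< x<y _ _ = ⊥-elim (different x∈A y∈A x<y (i , x∈i , y∈i))
      ... | tri≈ _ x≡y _ = x≡y
      ... | tri> _ _ y<x = ⊥-elim (different y∈A x∈A y<x (i , y∈i , x∈i))

theorem5p1 : (∀ a → ExcludedMiddle a) →
    ∀ {ℓ} (u : Ultrafilter ℤ ℓ) → Nonprincipal u →
    ⟨ℤ, 3 ⟩-Ramsey u → Selective u
theorem5p1 em = selective (em 0ℓ)
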